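{- Let $U$ be a nonempty finite set and let $f\in Cl(U)$ be a closure operation on $U$. Then the family of all minimal transversals of the family of minimal keys of $f$ equals the family of all minimal independent sets of $f$: $$Tr(Key(f))=MI(f).$$
   Context: Let $U$ be a nonempty finite set with power set $\mathcal{P}(U)$. A closure operation on $U$ is a map $f:\mathcal{P}(U)\to\mathcal{P}(U)$ such that for all $X,Y\subseteq U$: $X\subseteq f(X)$; $X\subseteq Y$ implies $f(X)\subseteq f(Y)$; and $f(f(X))=f(X)$. $Cl(U)$ is the set of all closure operations on $U$. A set $K\subseteq U$ is a key of $f$ if $f(K)=U$; a key $K$ is minimal if for every $a\in K$ the set $K\setminus\{a\}$ is not a key. $Key(f)$ is the set of all minimal keys of $f$. For $X\subseteq U$ put $I(X)=\{a\in U: a\notin f(X)\}=U\setminus f(X)$; such a set is called an independent set of $f$, and $I(f)=\{I(X):X\subseteq U\}$ is the family of all independent sets of $f$. $MI(f)$, the family of all minimal independent sets of $f$, consists of the inclusion-minimal nonempty members of $I(f)$, i.e. those $Y\in I(f)$ with $Y\neq\emptyset$ such that no nonempty $Z\in I(f)$ satisfies $Z\subsetneq Y$. For a family $\mathcal{H}$ of subsets of $U$ (a hypergraph; empty families and empty edges are allowed), a transversal of $\mathcal{H}$ is a set $T\subseteq U$ with $T\cap E\neq\emptyset$ for all $E\in\mathcal{H}$; it is minimal if no proper subset of $T$ is a transversal. $Tr(\mathcal{H})$ is the family of all minimal transversals of $\mathcal{H}$. In particular $Tr(\emptyset)=\{\emptyset\}$ and $Tr(\{\emptyset\})=\emptyset$.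 -}

module Defs where

open import Data.Fin.Subset using (Subset; _∈_; _⊆_; _⊂_; _∩_; _-_; ∁; ⊤; Nonempty)
open import Data.Nat.Base using (ℕ)
open import Data.Product.Base using (∃-syntax; _×_)
open import Level using (0ℓ)
open import Relation.Binary.PropositionalEquality.Core using (_≡_)
open import Relation.Nullary.Negation.Core using (¬_)
open import Relation.Unary using (Pred)

-- The ground set U is Fin n, its power set is Subset n, and a family of
-- subsets of U is a predicate on Subset n.
Family : ℕ → Set₁
Family n = Pred (Subset n) 0ℓ

record ClosureOperation (n : ℕ) : Set where
  field
    cl         : Subset n → Subset n
    extensive  : ∀ X → X ⊆ cl X
    monotone   : ∀ X Y → X ⊆ Y → cl X ⊆ cl Y
    idempotent : ∀ X → cl (cl X) ≡ cl X

module _ {n : ℕ} (f : ClosureOperation n) where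
  open ClosureOperation f

  IsKey : Subset n → Set
  IsKey K = cl K ≡ ⊤

  -- Minimal keys only.
  Key : Family n
  Key K = IsKey K × (∀ a → a ∈ K → ¬ IsKey (K - a))

  I : Subset n → Subset n
  I X = ∁ (cl X)

  Independent : Family n
  Independent Y = ∃[ X ] Y ≡ I X

  MI : Family n
  MI Y = Independent Y × Nonempty Y ×
         (∀ Z → Independent Z → Nonempty Z → ¬ (Z ⊂ Y))

module _ {n : ℕ} (H : Family n) where

  Transversal : Family n
  Transversal T = ∀ E → H E → Nonempty (T ∩ E)

  -- Minimal transversals only.
  Tr : Family n
  Tr T = Transversal T × (∀ S → S ⊂ T → ¬ Transversal S)

{-# OPTIONS --safe #-}
-- Transversals of Key f and nonempty independent sets are cofinal in each
-- other from below, so they have the same minimal elements.  A nonempty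
-- independent set U ∖ cl X is a transversal: a key avoiding it would lie in
-- cl X and force cl X = U.  Conversely a transversal T contains the
-- independent set I (∁ T), which is nonempty because a key inside ∁ T would
-- contain a minimal key avoiding T.
module Submission where

open import Defs
open import Data.Bool.Properties using () renaming (_≟_ to _≟ᵇ_)
open import Data.Fin.Properties using (any?)
open import Data.Fin.Subset
  using (Subset; _∈_; _⊆_; _⊂_; _∩_; _-_; ∁; ⊤; ⁅_⁆; Nonempty)
open import Data.Fin.Subset.Induction using (Acc; acc; ⊂-wellFounded)
open import Data.Fin.Subset.Properties
open import Data.Nat.Base using (ℕ; NonZero)
open import Data.Product.Base using (∃-syntax; _×_; _,_)
open import Data.Vec.Properties using (≡-dec)
open import Function.Base using (_∘_)
open import Relation.Binary.PropositionalEquality using (_≡_; refl; sym; subst)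
open import Relation.Nullary using (¬_; Dec; yes; no; contradiction; _×-dec_)
open import Relation.Nullary.Decidable using (decidable-stable)
open import Relation.Unary using (_≐_)

⊆∧⊄⇒≡ : ∀ {n} {p q : Subset n} → p ⊆ q → ¬ (p ⊂ q) → p ≡ q
⊆∧⊄⇒≡ {p = p} p⊆q p⊄q = ⊆-antisym p⊆q λ {x} x∈q →
  decidable-stable (x ∈? p) λ x∉p → p⊄q (p⊆q , x , x∈q , x∉p)

module _ {n : ℕ} (f : ClosureOperation n) where
  open ClosureOperation f

  isKey? : ∀ K → Dec (IsKey f K)
  isKey? K = ≡-dec _≟ᵇ_ (cl K) ⊤

  -- Deleting single elements while the result stays a key terminates, since `⊂` is well-founded.
  -- Where no deletion leaves a key, the failed search is exactly the minimality clause of `Key`.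
  ∃-minimalKey : ∀ {K} → IsKey f K → ∃[ E ] Key f E × E ⊆ K
  ∃-minimalKey = go (⊂-wellFounded _)
    where
    go : ∀ {K} → Acc _⊂_ K → IsKey f K → ∃[ E ] Key f E × E ⊆ K
    go {K} (acc rec) key with any? (λ a → a ∈? K ×-dec isKey? (K - a))
    ... | no ¬smaller = K , (key , λ a a∈K key′ → ¬smaller (a , a∈K , key′)) , ⊆-refl
    ... | yes (a , a∈K , key′) with go (rec (x∈p⇒p-x⊂p a∈K)) key′
    ...   | E , minE , E⊆K-a = E , minE , p─q⊆p K ⁅ a ⁆ ∘ E⊆K-a

  independent⇒transversal : ∀ {Y} → Independent f Y → Nonempty Y → Transversal (Key f) Y
  independent⇒transversal (X , refl) (y , y∈Y) E (key , _) =
    decidable-stable (nonempty? (I f X ∩ E)) λ disjoint →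
      let E⊆clX : E ⊆ cl X
          E⊆clX x∈E = x∉∁p⇒x∈p λ x∈Y → disjoint (_ , x∈p∩q⁺ (x∈Y , x∈E))
          y∈clE = subst (y ∈_) (sym key) ∈⊤
          -- Monotonicity carries `cl E`, which is all of `⊤`, into `cl (cl X)`; idempotence
          -- collapses that to `cl X`.
          y∈clX = subst (y ∈_) (idempotent X) (monotone E (cl X) E⊆clX y∈clE)
      in x∈∁p⇒x∉p y∈Y y∈clX

  -- By extensivity, a point outside `cl (∁ T)` is also outside `∁ T`.
  I∁⊆ : ∀ T → I f (∁ T) ⊆ T
  I∁⊆ T x∈I = x∉∁p⇒x∈p (x∈∁p⇒x∉p x∈I ∘ extensive (∁ T))

  transversal⇒I∁-nonempty : ∀ {T} → Transversal (Key f) T → Nonempty (I f (∁ T))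
  transversal⇒I∁-nonempty {T} trans =
    decidable-stable (nonempty? (I f (∁ T))) λ empty →
      let key : IsKey f (∁ T)
          key = ⊆-antisym ⊆⊤ λ _ → x∉∁p⇒x∈p λ x∈I → empty (_ , x∈I)
          E , minE , E⊆∁T = ∃-minimalKey key
          x , x∈T∩E = trans E minE
          x∈T , x∈E = x∈p∩q⁻ T E x∈T∩E
      in contradiction x∈T (x∈∁p⇒x∉p (E⊆∁T x∈E))

  Tr⊆MI : ∀ {T} → Tr (Key f) T → MI f T
  Tr⊆MI {T} (trans , minimal) =
    (∁ T , sym I≡T) , subst Nonempty I≡T nonempty ,
    λ Z ind ne Z⊂T → minimal Z Z⊂T (independent⇒transversal ind ne)
    where
    nonempty : Nonempty (I f (∁ T))
    nonempty = transversal⇒I∁-nonempty trans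

    I≡T : I f (∁ T) ≡ T
    -- `I f (∁ T)` is itself a transversal, so minimality of `T` forbids strict inclusion.
    I≡T = ⊆∧⊄⇒≡ (I∁⊆ T) λ I⊂T →
      minimal _ I⊂T (independent⇒transversal (∁ T , refl) nonempty)

  MI⊆Tr : ∀ {Y} → MI f Y → Tr (Key f) Y
  MI⊆Tr (ind , ne , minimal) = independent⇒transversal ind ne ,
    -- A transversal `S` strictly below `Y` would place the nonempty independent set `I f (∁ S)`
    -- strictly below `Y` as well.
    λ S S⊂Y trans → minimal (I f (∁ S)) (∁ S , refl)
      (transversal⇒I∁-nonempty trans) (⊆-⊂-trans (I∁⊆ S) S⊂Y)

theorem3p1 : (n : ℕ) .{{_ : NonZero n}} (f : ClosureOperation n) → Tr (Key f) ≐ MI f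
theorem3p1 n f = Tr⊆MI f , MI⊆Tr f
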